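{- If $T$ is a tree with $n$ vertices whose edges are colored with $\ell\geq 2$ colors, then $\operatorname{wld}(T)=n-1$.
   Context: An edge-colored graph $(G,\gamma)$ is a finite connected graph $G$ with a surjective function $\gamma:E(G)\to\mathcal{C}=\{c_1,\dots,c_\ell\}$ onto a finite set of colors (not necessarily a proper edge-coloring). For each color $c_i$ let $E_i(G)=\{e\in E(G):\gamma(e)=c_i\}$. For $W\subseteq E(G)$, let $G_i^W$ be the graph with vertex set $V(G)$ and edge set $W\cup E_i(G)$. The set $W$ is color-connecting if $G_i^W$ is connected for every color $c_i\in\mathcal{C}$. The wild number $\operatorname{wld}(G)$ is the minimum size of a color-connecting set. -}

module Defs where

open import Data.Fin using (Fin; zero; suc; fromℕ; inject₁; _<_; _≟_)
open import Data.Fin.Subset using (Subset; _∈_; _∪_; ⊤; ∣_∣)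
open import Data.Nat using (ℕ; suc; NonZero; _≤_)
open import Data.Product using (∃-syntax; _×_)
open import Data.Sum using (_⊎_)
open import Data.Vec using (tabulate)
open import Function.Bundles using (_↠_; module Surjection)
open import Function.Definitions using (Injective)
open import Relation.Binary.Construct.Closure.ReflexiveTransitive using (Star)
open import Relation.Binary.PropositionalEquality using (_≡_)
open import Relation.Nullary using (¬_; does)

-- A finite simple graph with vertex set Fin n and edge set Fin m.  The edge e
-- is the unordered pair {src e, tgt e}; the names src and tgt carry no
-- direction.  Listing the smaller endpoint first gives every 2-element set of
-- vertices a unique representative, so the two laws say exactly that there
-- are no loops and no parallel edges.
record Graph (n m : ℕ) : Set where
  field
    src tgt : Fin m → Fin n
    src<tgt : ∀ e → src e < tgt e
    simple  : ∀ {e f} → src e ≡ src f → tgt e ≡ tgt f → e ≡ f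

module _ {n m : ℕ} (G : Graph n m) where
  open Graph G

  Joins : Fin m → Fin n → Fin n → Set
  Joins e u v = (u ≡ src e × v ≡ tgt e) ⊎ (u ≡ tgt e × v ≡ src e)

  -- A set F of edges stands for the spanning subgraph (V(G), F); G itself is
  -- the case F = ⊤.
  Adjacent : Subset m → Fin n → Fin n → Set
  Adjacent F u v = ∃[ e ] (e ∈ F × Joins e u v)

  Connected : Subset m → Set
  Connected F = NonZero n × (∀ u v → Star (Adjacent F) u v)

  -- A cycle on k + 1 ≥ 3 distinct vertices v₀, …, vₖ.
  record Cycle (F : Subset m) : Set where
    field
      k        : ℕ
      2≤k      : 2 ≤ k
      vertex   : Fin (suc k) → Fin n
      distinct : Injective _≡_ _≡_ vertex
      step     : ∀ (i : Fin k) → Adjacent F (vertex (inject₁ i)) (vertex (suc i))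
      close    : Adjacent F (vertex (fromℕ k)) (vertex zero)

  IsTree : Set
  IsTree = Connected ⊤ × ¬ Cycle ⊤

record EdgeColoredGraph (n m ℓ : ℕ) : Set where
  field
    graph     : Graph n m
    connected : Connected graph ⊤
    coloring  : Fin m ↠ Fin ℓ

  γ : Fin m → Fin ℓ
  γ = Surjection.to coloring

module _ {n m ℓ : ℕ} (G : EdgeColoredGraph n m ℓ) where
  open EdgeColoredGraph G

  colorClass : Fin ℓ → Subset m
  colorClass c = tabulate (λ e → does (γ e ≟ c))

  ColorConnecting : Subset m → Set
  ColorConnecting W = ∀ c → Connected graph (W ∪ colorClass c)

  -- wld(G) = k, i.e. k is the minimum of ∣ W ∣ over color-connecting sets W.
  WildNumberIs : ℕ → Set
  WildNumberIs k =
      (∃[ W ] (ColorConnecting W × ∣ W ∣ ≡ k))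
    × (∀ W → ColorConnecting W → k ≤ ∣ W ∣)

{-# OPTIONS --safe #-}

-- Adding the edges of an acyclic graph one at a time, starting from n isolated
-- vertices, every new edge joins two different components, so the number of
-- components drops by one each time; a tree ends with a single component and
-- hence has n - 1 edges.  In a tree, moreover, an edge e missing from W would
-- have to be bypassed in W ∪ E_c for a color c other than that of e, and the
-- bypass together with e contains a cycle.  So the set of all edges is the only
-- color-connecting set.
module Submission where

open import Data.Bool using (true)
open import Data.Fin using (Fin; zero; suc; fromℕ; inject₁; _<_; _≟_)
open import Data.Fin.Properties using (<-irrefl; <-asym; suc-injective; any?)
open import Data.Fin.Subset using (Subset; inside; outside; _∈_; _∉_; _∪_; _-_; ⊤; ⁅_⁆; ∣_∣)
open import Data.Fin.Subset.Properties
  using (_∈?_; ∈⊤; ∣⊤∣≡n; ∣⁅x⁆∣≡1; x∈⁅x⁆; x∈⁅y⁆⇒x≡y; p─⊥≡p; p─q⊆p; x∈p∧x≢y⇒x∈p-y;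
         p⊆q⇒∣p∣≤∣q∣; p⊆p∪q; x∈p∪q⁻; ⊆-antisym)
open import Data.List using (List; []; _∷_; length; allFin)
open import Data.List.Membership.Propositional using () renaming (_∈_ to _∈ₗ_)
open import Data.List.Membership.Propositional.Properties using (∈-allFin)
open import Data.List.Properties using (length-tabulate)
import Data.List.Relation.Unary.All as All
import Data.List.Relation.Unary.AllPairs as AllPairs
open import Data.List.Relation.Unary.Any using (here; there)
open import Data.List.Relation.Unary.Unique.Propositional using (Unique)
open import Data.List.Relation.Unary.Unique.Propositional.Properties using (allFin⁺)
open import Data.Nat using (ℕ; suc; _+_; _≤_; _∸_; z≤n; s≤s; NonZero)
open import Data.Nat.Properties using (+-suc; +-identityʳ)
open import Data.Product using (_×_; _,_; proj₁; proj₂; ∃-syntax)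
open import Data.Sum using (inj₁; inj₂)
open import Data.Vec using (_∷_)
import Data.Vec as Vec
open import Data.Vec.Properties using ([]=⇒lookup; lookup∘tabulate)
open import Function using (id; _∘_)
open import Function.Definitions using (Injective)
open import Level using (0ℓ)
open import Relation.Binary using (Rel)
open import Relation.Binary.Construct.Closure.ReflexiveTransitive as Star
  using (Star; ε; _◅_; _◅◅_)
open import Relation.Binary.PropositionalEquality
open import Relation.Nullary using (¬_; yes; no; does; contradiction)
open import Relation.Unary using (Pred)
open import Defs

-- Keeps `count` balanced in `merge`, where exactly one root is lost for the edge gained.
∣p-x∣+1≡∣p∣ : ∀ {n} {p : Subset n} {x} → x ∈ p → suc ∣ p - x ∣ ≡ ∣ p ∣
∣p-x∣+1≡∣p∣ {p = inside  ∷ p} {zero}  Vec.here        = cong (suc ∘ ∣_∣) (p─⊥≡p p)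
∣p-x∣+1≡∣p∣ {p = inside  ∷ p} {suc x} (Vec.there x∈p) = cong suc (∣p-x∣+1≡∣p∣ x∈p)
∣p-x∣+1≡∣p∣ {p = outside ∷ p} {suc x} (Vec.there x∈p) = ∣p-x∣+1≡∣p∣ x∈p

x∉p-x : ∀ {n} (p : Subset n) x → x ∉ p - x
x∉p-x (_ ∷ p) zero    ()
x∉p-x (_ ∷ p) (suc x) (Vec.there x∈p-x) = x∉p-x p x x∈p-x

other-element : ∀ {ℓ} → 2 ≤ ℓ → (c : Fin ℓ) → ∃[ d ] c ≢ d
other-element (s≤s (s≤s z≤n)) zero    = suc zero , λ ()
other-element (s≤s (s≤s z≤n)) (suc _) = zero , λ ()

-- The fields mirror those of `Cycle`, so a simple path with at least two steps turns into a cycle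
-- once an edge joins its ends.
record SimplePath {n} (R : Rel (Fin n) 0ℓ) (u v : Fin n) : Set where
  field
    k        : ℕ
    vertex   : Fin (suc k) → Fin n
    distinct : Injective _≡_ _≡_ vertex
    step     : ∀ (i : Fin k) → R (vertex (inject₁ i)) (vertex (suc i))
    start    : vertex zero ≡ u
    end      : vertex (fromℕ k) ≡ v

module _ {n} {R : Rel (Fin n) 0ℓ} where
  open SimplePath

  trivial : ∀ u → SimplePath R u u
  trivial u = record
    { k = 0 ; vertex = λ _ → u ; distinct = λ { {zero} {zero} _ → refl }
    ; step = λ () ; start = refl ; end = refl }

  suffix : ∀ {u v} (p : SimplePath R u v) i → SimplePath R (vertex p i) v
  suffix p zero = record
    { k = k p ; vertex = vertex p ; distinct = distinct p ; step = step p
    ; start = refl ; end = end p }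
  suffix p@record { k = suc k } (suc i) = suffix
    record { k = k ; vertex = vertex p ∘ suc ; distinct = suc-injective ∘ distinct p
           ; step = step p ∘ suc ; start = refl ; end = end p } i

  extend : ∀ {u w v} → R u w → (p : SimplePath R w v) → (∀ i → vertex p i ≢ u) →
           SimplePath R u v
  extend {u} r p fresh = record
    { k = suc (k p) ; vertex = vertex′ ; distinct = distinct′ ; step = step′
    ; start = refl ; end = end p }
    where
    vertex′ : Fin (suc (suc (k p))) → Fin n
    vertex′ zero    = u
    vertex′ (suc i) = vertex p i

    distinct′ : Injective _≡_ _≡_ vertex′
    distinct′ {zero}  {zero}  _  = refl
    distinct′ {zero}  {suc j} eq = contradiction (sym eq) (fresh j)
    distinct′ {suc i} {zero}  eq = contradiction eq (fresh i)
    distinct′ {suc i} {suc j} eq = cong suc (distinct p eq)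

    step′ : ∀ i → R (vertex′ (inject₁ i)) (vertex′ (suc i))
    step′ zero    = subst (R u) (sym (start p)) r
    step′ (suc i) = step p i

  -- Loop erasure: if the simple path built from the rest of the walk already visits `u`, everything
  -- before that visit is dropped; otherwise `u` is put in front.
  simplePath : ∀ {u v} → Star R u v → SimplePath R u v
  simplePath ε = trivial _
  simplePath {u} (r ◅ rs) with simplePath rs
  ... | p with any? (λ i → vertex p i ≟ u)
  ...   | yes (i , eq) = subst (λ w → SimplePath R w _) eq (suffix p i)
  ...   | no fresh     = extend r p (λ i eq → fresh (i , eq))

module _ {n m : ℕ} (G : Graph n m) where
  open Graph G

  -- A predicate on edges covers both "other than `e`" and "in the list `es`"; for `_∈ F` with a
  -- subset `F` this is `Adjacent G F`.
  Via : Pred (Fin m) 0ℓ → Rel (Fin n) 0ℓ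
  Via P u v = ∃[ f ] (P f × Joins G f u v)

  via-map : ∀ {P Q : Pred (Fin m) 0ℓ} → (∀ {f} → P f → Q f) →
            ∀ {u v} → Via P u v → Via Q u v
  via-map P⇒Q (f , Pf , j) = f , P⇒Q Pf , j

  via-sym : ∀ {P : Pred (Fin m) 0ℓ} {u v} → Via P u v → Via P v u
  via-sym (f , Pf , inj₁ (p , q)) = f , Pf , inj₂ (q , p)
  via-sym (f , Pf , inj₂ (p , q)) = f , Pf , inj₁ (q , p)

  joins-endpoints⇒≡ : ∀ {e f} → Joins G f (src e) (tgt e) → f ≡ e
  joins-endpoints⇒≡ (inj₁ (p , q)) = simple (sym p) (sym q)
  joins-endpoints⇒≡ {e} {f} (inj₂ (p , q)) =
    contradiction (subst₂ _<_ p q (src<tgt e)) (<-asym (src<tgt f))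

  -- By the length of a simple bypass: with no step `e` would be a loop, a single step would use an
  -- edge parallel to `e` and hence `e` itself, and a longer path is closed to a cycle by `e`.
  acyclic⇒no-bypass : ¬ Cycle G ⊤ → ∀ e → ¬ Star (Via (_≢ e)) (src e) (tgt e)
  acyclic⇒no-bypass acyclic e walk = no-simple-bypass (simplePath walk)
    where
    no-simple-bypass : ¬ SimplePath (Via (_≢ e)) (src e) (tgt e)
    no-simple-bypass record { k = 0 ; start = s ; end = t } =
      <-irrefl (trans (sym s) t) (src<tgt e)
    no-simple-bypass record { k = 1 ; step = step ; start = s ; end = t }
      with f , f≢e , j ← step zero = f≢e (joins-endpoints⇒≡ (subst₂ (Joins G f) s t j))
    no-simple-bypass record { k = suc (suc k) ; vertex = vertex ; distinct = distinct
                            ; step = step ; start = s ; end = t } =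
      acyclic record
        { k = suc (suc k) ; 2≤k = s≤s (s≤s z≤n) ; vertex = vertex ; distinct = distinct
        ; step = via-map (λ _ → ∈⊤) ∘ step
        ; close = e , ∈⊤ , inj₂ (t , s) }

  -- The components of (V(G), es), each represented by one of its vertices, its
  -- root.
  record Components (es : List (Fin m)) : Set where
    field
      root       : Fin n → Fin n
      roots      : Subset n
      root∈roots : ∀ v → root v ∈ roots
      root-fixed : ∀ {v} → v ∈ roots → root v ≡ v
      to-root    : ∀ v → Star (Via (_∈ₗ es)) v (root v)
      root-edge  : ∀ {e} → e ∈ₗ es → root (src e) ≡ root (tgt e)
      count      : ∣ roots ∣ + length es ≡ n

  discrete : Components []
  discrete = record
    { root = id ; roots = ⊤ ; root∈roots = λ _ → ∈⊤ ; root-fixed = λ _ → refl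
    ; to-root = λ _ → ε ; root-edge = λ ()
    ; count = trans (+-identityʳ _) (∣⊤∣≡n n) }

  module _ {e : Fin m} {es : List (Fin m)} (C : Components es) where
    open Components C

    private
      a b : Fin n
      a = root (src e)
      b = root (tgt e)

    -- The component of `b` is absorbed into that of `a`: `b` stops being a root, and every vertex
    -- that had root `b` gets root `a`. Since `a` differs from `b`, it survives as a root.
    merge : a ≢ b → Components (e ∷ es)
    merge a≢b = record
      { root       = redirect ∘ root
      ; roots      = roots - b
      ; root∈roots = λ v → redirect∈ (root∈roots v)
      ; root-fixed = λ {v} v∈ → trans (cong redirect (root-fixed (p─q⊆p roots ⁅ b ⁆ v∈)))
                                      (redirect-≢ λ { refl → x∉p-x roots b v∈ })
      ; to-root    = λ v → Star.map (via-map there) (to-root v) ◅◅ to-redirect (root v)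
      ; root-edge  = λ { (here refl) → trans (redirect-≢ a≢b) (sym redirect-b)
                       ; (there f∈) → cong redirect (root-edge f∈) }
      ; count      = trans (+-suc _ _)
                       (trans (cong (_+ length es) (∣p-x∣+1≡∣p∣ (root∈roots (tgt e)))) count)
      }
      where
      redirect : Fin n → Fin n
      redirect r with r ≟ b
      ... | yes _ = a
      ... | no  _ = r

      redirect-≢ : ∀ {r} → r ≢ b → redirect r ≡ r
      redirect-≢ {r} r≢b with r ≟ b
      ... | yes r≡b = contradiction r≡b r≢b
      ... | no  _   = refl

      redirect-b : redirect b ≡ a
      redirect-b with b ≟ b
      ... | yes _  = refl
      ... | no b≢b = contradiction refl b≢b

      redirect∈ : ∀ {r} → r ∈ roots → redirect r ∈ roots - b
      redirect∈ {r} r∈ with r ≟ b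
      ... | yes _  = x∈p∧x≢y⇒x∈p-y (root∈roots (src e)) a≢b
      ... | no r≢b = x∈p∧x≢y⇒x∈p-y r∈ r≢b

      to-redirect : ∀ r → Star (Via (_∈ₗ e ∷ es)) r (redirect r)
      to-redirect r with r ≟ b
      ... | no _     = ε
      ... | yes refl =
        -- From `b` back to `tgt e`, across `e` to `src e`, and on to `a`.
        Star.reverse via-sym (Star.map (via-map there) (to-root (tgt e)))
        ◅◅ (e , here refl , inj₂ (refl , refl))
        ◅ Star.map (via-map there) (to-root (src e))

  -- If the ends of a new edge `e` had the same root, the walks to it inside `es` would bypass `e`,
  -- because `es` does not contain `e`.
  acyclic⇒components : ¬ Cycle G ⊤ → ∀ {es} → Unique es → Components es
  acyclic⇒components acyclic AllPairs.[] = discrete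
  acyclic⇒components acyclic {e ∷ es} (e∉es AllPairs.∷ unique) = merge C λ a≡b →
    acyclic⇒no-bypass acyclic e
      (Star.map (via-map λ f∈es f≡e → All.lookup e∉es f∈es (sym f≡e))
        (subst (Star _ (src e)) a≡b (to-root (src e))
         ◅◅ Star.reverse via-sym (to-root (tgt e))))
    where
    C = acyclic⇒components acyclic unique
    open Components C

  -- With all `m` edges listed, `count` says that the number of roots plus `m` is `n`. Roots agree
  -- along edges, hence along walks, so connectedness leaves a single root.
  tree⇒1+m≡n : IsTree G → suc m ≡ n
  tree⇒1+m≡n ((nonZero , walk) , acyclic) =
    trans (cong₂ _+_ (sym ∣roots∣≡1) (sym (length-tabulate {n = m} id))) count
    where
    open Components (acyclic⇒components acyclic (allFin⁺ m))

    root-joins : ∀ {u v} → Via (_∈ ⊤) u v → root u ≡ root v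
    root-joins (f , _ , inj₁ (refl , refl)) = root-edge (∈-allFin f)
    root-joins (f , _ , inj₂ (refl , refl)) = sym (root-edge (∈-allFin f))

    root-const : ∀ u v → root u ≡ root v
    root-const u v = Star.fold (λ u v → root u ≡ root v) (trans ∘ root-joins) refl (walk u v)

    someVertex : ∀ {n} → NonZero n → Fin n
    someVertex {suc _} _ = zero

    r : Fin n
    r = root (someVertex nonZero)

    ∣roots∣≡1 : ∣ roots ∣ ≡ 1
    ∣roots∣≡1 = trans (cong ∣_∣ roots≡⁅r⁆) (∣⁅x⁆∣≡1 r)
      where
      roots≡⁅r⁆ : roots ≡ ⁅ r ⁆
      roots≡⁅r⁆ = ⊆-antisym
        -- An element of `roots` is its own root, and all vertices share the root `r`.
        (λ {v} v∈ → subst (_∈ ⁅ r ⁆) (trans (root-const _ v) (root-fixed v∈)) (x∈⁅x⁆ r))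
        (λ v∈ → subst (_∈ roots) (sym (x∈⁅y⁆⇒x≡y r v∈)) (root∈roots _))

module _ {n m ℓ : ℕ} (T : EdgeColoredGraph n m ℓ) where
  open EdgeColoredGraph T
  open Graph graph

  ∈colorClass⇒γ≡ : ∀ {c e} → e ∈ colorClass T c → γ e ≡ c
  ∈colorClass⇒γ≡ {c} {e} e∈ = does⇒≡ (trans (sym (lookup∘tabulate _ e)) ([]=⇒lookup e∈))
    where
    does⇒≡ : does (γ e ≟ c) ≡ true → γ e ≡ c
    does⇒≡ eq with γ e ≟ c
    ... | yes γe≡c = γe≡c

  ⊤-colorConnecting : ColorConnecting T ⊤
  ⊤-colorConnecting c = proj₁ connected , λ u v →
    Star.map (via-map graph (p⊆p∪q (colorClass T c))) (proj₂ connected u v)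

  colorConnecting⇒∈ : ¬ Cycle graph ⊤ → 2 ≤ ℓ → ∀ {W} → ColorConnecting T W → ∀ e → e ∈ W
  colorConnecting⇒∈ acyclic 2≤ℓ {W} connecting e with e ∈? W
  ... | yes e∈W = e∈W
  -- Now `e` lies neither in `W` nor in the class of `c`, so the walk between its ends that
  -- connectedness for `c` provides avoids `e`.
  ... | no  e∉W with c , γe≢c ← other-element 2≤ℓ (γ e) =
    contradiction
      (Star.map (via-map graph λ { f∈ refl → e∉ f∈ }) (proj₂ (connecting c) (src e) (tgt e)))
      (acyclic⇒no-bypass graph acyclic e)
    where
    e∉ : e ∉ W ∪ colorClass T c
    e∉ e∈ with x∈p∪q⁻ W (colorClass T c) e∈
    ... | inj₁ e∈W = e∉W e∈W
    ... | inj₂ e∈c = γe≢c (∈colorClass⇒γ≡ e∈c)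

corollary3p2 : ∀ {n m ℓ : ℕ} (T : EdgeColoredGraph n m ℓ) → IsTree (EdgeColoredGraph.graph T) → 2 ≤ ℓ → WildNumberIs T (n ∸ 1)
corollary3p2 {n} {m} T tree 2≤ℓ =
  -- As `suc m ∸ 1` reduces to `m`, it remains to show that the wild number is the number of edges.
  subst (WildNumberIs T) (cong (_∸ 1) (tree⇒1+m≡n (EdgeColoredGraph.graph T) tree))
    ( (⊤ , ⊤-colorConnecting T , ∣⊤∣≡n m)
    , λ W connecting → subst (_≤ ∣ W ∣) (∣⊤∣≡n m)
        (p⊆q⇒∣p∣≤∣q∣ {p = ⊤} λ {e} _ → colorConnecting⇒∈ T (proj₂ tree) 2≤ℓ connecting e) )
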